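{- In the worst violated constraint model, there is no algorithm which, given oracle access to an arbitrary hidden 1SAT instance $\Phi$ (with repeated clauses allowed) which is unsatisfiable, learns all the literals present in $\Phi$, even if the algorithm is allowed arbitrarily many queries to the oracle.
   Context: A 1SAT instance on Boolean variables $x_1,\dots,x_n$ is a conjunction of clauses $C_1,\dots,C_m$, each consisting of a single literal ($x_i$ or $\overline{x}_i$). The same literal may occur as several different clauses. Worst violated constraint model: the formula is hidden and is accessed only through an oracle. A query is a probabilistic assignment $\mathbf{a}:[n]\to[0,1]$, meaning that $\Pr[x_i=1]=\mathbf{a}(i)$ and $\Pr[\overline{x}_i=1]=1-\mathbf{a}(i)$. The violation probability of a clause is the probability that its literal is $0$. If all clauses have violation probability $0$, the oracle reports that the formula is satisfied; otherwise it returns the index $j\in[m]$ of a clause with the highest violation probability, breaking ties arbitrarily. The tie-breaking may be adversarial, and an algorithm is required to be correct for every valid behaviour of the oracle. An algorithm "learns all the literals present in $\Phi$" if it outputs the set of literals that occur as clauses of $\Phi$. -}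

module Defs where

open import Data.Bool using (Bool; true; not)
open import Data.Fin using (Fin)
open import Data.List using (List; []; _∷_)
open import Data.List.Membership.Propositional using (_∈_)
open import Data.Nat using (ℕ) renaming (_≤_ to _≤ⁿ_)
open import Data.Product using (_×_; _,_; ∃-syntax)
open import Data.Rational using (ℚ; 0ℚ; 1ℚ; _+_; _-_; -_; ∣_∣; _<_; _≤_)
open import Data.Rational.Properties
  using (+-inverseʳ; +-identityˡ; +-comm; +-assoc; neg-distrib-+; ∣-p∣≡∣p∣)
open import Data.Sum using (_⊎_; inj₁; inj₂)
open import Function.Bundles using (_⇔_)
open import Relation.Binary.PropositionalEquality
  using (_≡_; sym; trans; cong; subst; module ≡-Reasoning)
open import Relation.Nullary using (¬_)

-- Real numbers as Cauchy sequences of rationals. Equality of reals is _≃_,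
-- not _≡_.

IsCauchy : (ℕ → ℚ) → Set
IsCauchy s = ∀ ε → 0ℚ < ε →
  ∃[ N ] (∀ m n → N ≤ⁿ m → N ≤ⁿ n → ∣ s m - s n ∣ < ε)

record ℝ : Set where
  constructor mkℝ
  field
    seq    : ℕ → ℚ
    cauchy : IsCauchy seq

open ℝ public

infix 4 _≤ᴿ_ _≃_

_≤ᴿ_ : ℝ → ℝ → Set
x ≤ᴿ y = ∀ ε → 0ℚ < ε → ∃[ N ] (∀ n → N ≤ⁿ n → seq x n ≤ seq y n + ε)

_≃_ : ℝ → ℝ → Set
x ≃ y = x ≤ᴿ y × y ≤ᴿ x

fromℚ : ℚ → ℝ
fromℚ q = mkℝ (λ _ → q) λ ε 0<ε →
  0 , λ _ _ _ _ → subst (_< ε) (sym (cong ∣_∣ (+-inverseʳ q))) 0<ε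

0ᴿ 1ᴿ : ℝ
0ᴿ = fromℚ 0ℚ
1ᴿ = fromℚ 1ℚ

∣1-p-[1-q]∣ : ∀ p q → ∣ (1ℚ - p) - (1ℚ - q) ∣ ≡ ∣ p - q ∣
∣1-p-[1-q]∣ p q = trans (cong ∣_∣ eq) (∣-p∣≡∣p∣ (p - q))
  where
  open ≡-Reasoning
  eq : (1ℚ - p) - (1ℚ - q) ≡ - (p - q)
  eq = begin
    (1ℚ - p) - (1ℚ - q)
      ≡⟨ cong ((1ℚ - p) +_) (neg-distrib-+ 1ℚ (- q)) ⟩
    (1ℚ - p) + (- 1ℚ - - q)
      ≡⟨ cong (_+ (- 1ℚ - - q)) (+-comm 1ℚ (- p)) ⟩
    (- p + 1ℚ) + (- 1ℚ - - q)
      ≡⟨ +-assoc (- p) 1ℚ (- 1ℚ - - q) ⟩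
    - p + (1ℚ + (- 1ℚ - - q))
      ≡⟨ cong (- p +_) (sym (+-assoc 1ℚ (- 1ℚ) (- - q))) ⟩
    - p + (0ℚ + - - q)
      ≡⟨ cong (- p +_) (+-identityˡ (- - q)) ⟩
    - p + - - q
      ≡⟨ sym (neg-distrib-+ p (- q)) ⟩
    - (p - q) ∎

infix 8 1-_

1-_ : ℝ → ℝ
1- x = mkℝ (λ n → 1ℚ - seq x n) λ ε 0<ε →
  let N , close = cauchy x ε 0<ε in
  N , λ m n N≤m N≤n →
    subst (_< ε) (sym (∣1-p-[1-q]∣ (seq x m) (seq x n))) (close m n N≤m N≤n)

data Literal (n : ℕ) : Set where
  pos neg : Fin n → Literal n

-- A clause is a single literal; Φ j is the clause with index j, and Φ need
-- not be injective.
Instance : ℕ → ℕ → Set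
Instance n m = Fin m → Literal n

evaluate : ∀ {n} → (Fin n → Bool) → Literal n → Bool
evaluate α (pos i) = α i
evaluate α (neg i) = not (α i)

Satisfiable : ∀ {n m} → Instance n m → Set
Satisfiable Φ = ∃[ α ] (∀ j → evaluate α (Φ j) ≡ true)

Unsatisfiable : ∀ {n m} → Instance n m → Set
Unsatisfiable Φ = ¬ Satisfiable Φ

record UnitInterval : Set where
  constructor mkUnit
  field
    value : ℝ
    0≤    : 0ᴿ ≤ᴿ value
    ≤1    : value ≤ᴿ 1ᴿ

open UnitInterval public

Query : ℕ → Set
Query n = Fin n → UnitInterval

prob-true : ∀ {n} → Query n → Literal n → ℝ
prob-true a (pos i) = value (a i)
prob-true a (neg i) = 1- value (a i)

violation : ∀ {n} → Query n → Literal n → ℝ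
violation a ℓ = 1- prob-true a ℓ

data Answer (m : ℕ) : Set where
  satisfied : Answer m
  violated  : Fin m → Answer m

AllZero : ∀ {n m} → Instance n m → Query n → Set
AllZero Φ a = ∀ j → violation a (Φ j) ≃ 0ᴿ

data Valid {n m} (Φ : Instance n m) (a : Query n) : Answer m → Set where
  satisfied : AllZero Φ a → Valid Φ a satisfied
  violated  : ∀ {j} → ¬ AllZero Φ a →
              (∀ k → violation a (Φ k) ≤ᴿ violation a (Φ j)) →
              Valid Φ a (violated j)

-- Given the answers received so far (most recent first), an algorithm either
-- asks a further query or stops and outputs a finite set of literals. Its own
-- earlier queries are determined by earlier answers. Nothing here bounds the
-- number of queries or forces the algorithm to stop.
Algorithm : ℕ → ℕ → Set
Algorithm n m = List (Answer m) → Query n ⊎ List (Literal n)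

IsLiteralSet : ∀ {n m} → Instance n m → List (Literal n) → Set
IsLiteralSet Φ S = ∀ ℓ → ℓ ∈ S ⇔ (∃[ j ] Φ j ≡ ℓ)

-- LearnsFrom A Φ h: continuing from the answers h, the algorithm stops with
-- the correct output however the oracle breaks ties. Being inductive, the
-- predicate excludes infinite runs; the oracle's choice among valid answers
-- may depend on the whole history.
data LearnsFrom {n m} (A : Algorithm n m) (Φ : Instance n m)
                (h : List (Answer m)) : Set where
  stop : ∀ {S} → A h ≡ inj₂ S → IsLiteralSet Φ S → LearnsFrom A Φ h
  ask  : ∀ {a} → A h ≡ inj₁ a →
         (∀ r → Valid Φ a r → LearnsFrom A Φ (r ∷ h)) →
         LearnsFrom A Φ h

Learns : ∀ {n m} → Algorithm n m → Instance n m → Set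
Learns A Φ = LearnsFrom A Φ []

{-# OPTIONS --safe #-}

-- Put two contradictory pairs x₀, x̄₀ and x₁, x̄₁ on the same four clause indices,
-- regarded as a 2 × 2 grid: one instance reads off the row, the other the column.
-- If row i holds a worst violated literal of the first instance and column j one
-- of the second, then cell (i , j) is a valid answer for both. An oracle that
-- always answers in this way never separates the two instances. Order of reals is
-- undecidable, so worst violated literals are only available up to double
-- negation, which suffices for a refutation.

module Submission where

open import Defs
open import Data.Bool using (true; false)
open import Data.Fin using (Fin; zero; suc; remQuot; combine)
open import Data.Fin.Properties using (remQuot-combine)
open import Data.Integer using (+_; -[1+_])
open import Data.Nat using (ℕ; _⊔_) renaming (_≤_ to _≤ⁿ_)
open import Data.Nat.Properties using (m≤m⊔n; m≤n⊔m)
  renaming (≤-refl to ≤ⁿ-refl; ≤-trans to ≤ⁿ-trans)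
open import Data.Product using (Σ-syntax; ∃-syntax; _×_; _,_; proj₁; proj₂)
open import Data.Rational using
  (ℚ; mkℚ; 0ℚ; 1ℚ; ½; _+_; _-_; _*_; ∣_∣; _<_; _≤_; _≤?_; positive)
open import Data.Rational.Properties
  using (≤-refl; <⇒≤; ≰⇒>; neg<pos; +-mono-≤; +-monoˡ-≤; +-monoʳ-≤;
         +-identityʳ; positive⁻¹; pos*pos⇒pos; module ≤-Reasoning)
open import Data.Rational.Solver using (module +-*-Solver)
open import Function using (_∘_)
open import Function.Bundles using (Equivalence)
open import Function.Definitions using (StrictlySurjective)
open import Relation.Binary.PropositionalEquality using (_≡_; refl; sym; trans; cong; subst)
open import Relation.Nullary using (¬_; yes; no; contradiction)
open import Relation.Nullary.Decidable using (from-no)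

p≤∣p∣ : ∀ p → p ≤ ∣ p ∣
p≤∣p∣ (mkℚ (+ _) _ _)      = ≤-refl
p≤∣p∣ p@(mkℚ -[1+ _ ] _ _) = <⇒≤ (neg<pos p ∣ p ∣)

∣p-q∣<r⇒p≤q+r : ∀ {p q r} → ∣ p - q ∣ < r → p ≤ q + r
∣p-q∣<r⇒p≤q+r {p} {q} {r} ∣p-q∣<r = begin
  p             ≡⟨ solve 2 (λ p q → p := q :+ (p :- q)) refl p q ⟩
  q + (p - q)   ≤⟨ +-monoʳ-≤ q (p≤∣p∣ (p - q)) ⟩
  q + ∣ p - q ∣ ≤⟨ +-monoʳ-≤ q (<⇒≤ ∣p-q∣<r) ⟩
  q + r         ∎
  where
  open ≤-Reasoning
  open +-*-Solver

p≤p+q : ∀ p {q} → 0ℚ < q → p ≤ p + q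
p≤p+q p {q} 0<q = begin
  p      ≡⟨ +-identityʳ p ⟨
  p + 0ℚ ≤⟨ +-monoʳ-≤ p (<⇒≤ 0<q) ⟩
  p + q  ∎
  where open ≤-Reasoning

0<½*p : ∀ {p} → 0ℚ < p → 0ℚ < ½ * p
0<½*p {p} 0<p = positive⁻¹ (½ * p) {{pos*pos⇒pos ½ p {{positive 0<p}}}}

≤ᴿ-refl : ∀ x → x ≤ᴿ x
≤ᴿ-refl x ε 0<ε = 0 , λ n _ → p≤p+q (seq x n) 0<ε

-- Beyond a common Cauchy modulus N for ε / 4, either seq y N ≤ seq x N + ε / 2,
-- which gives seq y n ≤ seq x n + ε for n ≥ N, or seq x n ≤ seq y n for all n ≥ N.
≰ᴿ⇒≥ᴿ : ∀ x y → ¬ x ≤ᴿ y → y ≤ᴿ x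
≰ᴿ⇒≥ᴿ x y x≰y ε 0<ε = N , y≤x+ε
  where
  open ≤-Reasoning
  open +-*-Solver

  h q : ℚ
  h = ½ * ε
  q = ½ * h

  modulusˣ = cauchy x q (0<½*p (0<½*p 0<ε))
  modulusʸ = cauchy y q (0<½*p (0<½*p 0<ε))

  N : ℕ
  N = proj₁ modulusˣ ⊔ proj₁ modulusʸ

  Nˣ≤N = m≤m⊔n (proj₁ modulusˣ) (proj₁ modulusʸ)
  Nʸ≤N = m≤n⊔m (proj₁ modulusˣ) (proj₁ modulusʸ)

  closeˣ : ∀ m n → N ≤ⁿ m → N ≤ⁿ n → seq x m ≤ seq x n + q
  closeˣ m n N≤m N≤n =
    ∣p-q∣<r⇒p≤q+r (proj₂ modulusˣ m n (≤ⁿ-trans Nˣ≤N N≤m) (≤ⁿ-trans Nˣ≤N N≤n))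

  closeʸ : ∀ m n → N ≤ⁿ m → N ≤ⁿ n → seq y m ≤ seq y n + q
  closeʸ m n N≤m N≤n =
    ∣p-q∣<r⇒p≤q+r (proj₂ modulusʸ m n (≤ⁿ-trans Nʸ≤N N≤m) (≤ⁿ-trans Nʸ≤N N≤n))

  y≤x+ε : ∀ n → N ≤ⁿ n → seq y n ≤ seq x n + ε
  y≤x+ε n N≤n with seq y N ≤? seq x N + h
  ... | yes yN≤xN+h = begin
    seq y n               ≤⟨ closeʸ n N N≤n ≤ⁿ-refl ⟩
    seq y N + q           ≤⟨ +-monoˡ-≤ q yN≤xN+h ⟩
    seq x N + h + q       ≤⟨ +-monoˡ-≤ q (+-monoˡ-≤ h (closeˣ N n ≤ⁿ-refl N≤n)) ⟩
    seq x n + q + h + q   ≡⟨ solve 2 (λ u e →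
                               u :+ con ½ :* (con ½ :* e) :+ con ½ :* e :+ con ½ :* (con ½ :* e)
                               := u :+ e) refl (seq x n) ε ⟩
    seq x n + ε           ∎
  ... | no yN≰xN+h = contradiction x≤y x≰y
    where
    x≤y : x ≤ᴿ y
    x≤y δ 0<δ = N , λ k N≤k → begin
      seq x k             ≤⟨ closeˣ k N N≤k ≤ⁿ-refl ⟩
      seq x N + q         ≡⟨ solve 2 (λ u h →
                               u :+ con ½ :* h := u :+ h :- con ½ :* h) refl (seq x N) h ⟩
      seq x N + h - q     ≤⟨ +-monoˡ-≤ _ (<⇒≤ (≰⇒> yN≰xN+h)) ⟩
      seq y N - q         ≤⟨ +-monoˡ-≤ _ (closeʸ N k ≤ⁿ-refl N≤k) ⟩
      seq y k + q - q     ≡⟨ solve 2 (λ u v → u :+ v :- v := u) refl (seq y k) q ⟩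
      seq y k             ≤⟨ p≤p+q (seq y k) 0<δ ⟩
      seq y k + δ         ∎

-- At a common late index both terms are at most 1/4, yet they sum to 1, so `1ℚ ≤ ½` would follow.
¬x≃0×1-x≃0 : ∀ x → ¬ (x ≃ 0ᴿ × 1- x ≃ 0ᴿ)
¬x≃0×1-x≃0 x ((x≤0 , _) , (1-x≤0 , _)) = from-no (1ℚ ≤? ½) (begin
  1ℚ                        ≡⟨ solve 1 (λ u → con 1ℚ := u :+ (con 1ℚ :- u)) refl (seq x n) ⟩
  seq x n + (1ℚ - seq x n)  ≤⟨ +-mono-≤ (proj₂ below n (m≤m⊔n _ _))
                                        (proj₂ below′ n (m≤n⊔m (proj₁ below) _)) ⟩
  ½                         ∎)
  where
  open ≤-Reasoning
  open +-*-Solver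
  below  = x≤0 (½ * ½) (positive⁻¹ (½ * ½))
  below′ = 1-x≤0 (½ * ½) (positive⁻¹ (½ * ½))
  n = proj₁ below ⊔ proj₁ below′

contradictoryPair : ∀ {n} → Fin n → Instance n 2
contradictoryPair i zero       = pos i
contradictoryPair i (suc zero) = neg i

-- If no index were a valid answer, then `v⁺ ≤ᴿ v⁻` would fail, since it makes the negative clause
-- worst. Its failure gives `v⁻ ≤ᴿ v⁺`, which makes the positive clause worst.
contradictoryPair-violated : ∀ {n} (i : Fin n) a →
  ¬ ¬ (∃[ j ] Valid (contradictoryPair i) a (violated j))
contradictoryPair-violated i a none = none (zero , violated nonzero λ
  { zero       → ≤ᴿ-refl v⁺
  ; (suc zero) → ≰ᴿ⇒≥ᴿ v⁺ v⁻ λ v⁺≤v⁻ → none (suc zero , violated nonzero λ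
      { zero       → v⁺≤v⁻
      ; (suc zero) → ≤ᴿ-refl v⁻ }) })
  where
  v⁺ = violation a (pos i)
  v⁻ = violation a (neg i)
  nonzero : ¬ AllZero (contradictoryPair i) a
  -- By definition `v⁻` is `1- v⁺`, so the two violations cannot both vanish.
  nonzero zeros = ¬x≃0×1-x≃0 v⁺ (zeros zero , zeros (suc zero))

module _ {n l m} (Φ : Instance n l) {f : Fin m → Fin l} (f-surj : StrictlySurjective _≡_ f) where

  reindex-∀ : {P : Literal n → Set} → (∀ k → P (Φ (f k))) → ∀ j → P (Φ j)
  reindex-∀ {P} all j = let k , fk≡j = f-surj j in subst (P ∘ Φ) fk≡j (all k)

  reindex-unsatisfiable : Unsatisfiable Φ → Unsatisfiable (Φ ∘ f)
  reindex-unsatisfiable unsat (α , sat) =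
    unsat (α , reindex-∀ {λ ℓ → evaluate α ℓ ≡ true} sat)

  -- Maximality over all clauses restricts along any `f`. Surjectivity serves the other condition:
  -- if all reindexed clauses had violation zero, so would all clauses of `Φ`.
  reindex-violated : ∀ {a k} → Valid Φ a (violated (f k)) → Valid (Φ ∘ f) a (violated k)
  reindex-violated {a} (violated nonzero worst) =
    violated (nonzero ∘ reindex-∀ {λ ℓ → violation a ℓ ≃ 0ᴿ}) (worst ∘ f)

contradictoryPair-unsatisfiable : ∀ {n} (i : Fin n) → Unsatisfiable (contradictoryPair i)
contradictoryPair-unsatisfiable i (α , sat) with α i | sat zero | sat (suc zero)
... | true  | _  | ()
... | false | () | _

row column : Fin 4 → Fin 2
row    = proj₁ ∘ remQuot {2} 2
column = proj₂ ∘ remQuot {2} 2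

row-surjective : StrictlySurjective _≡_ row
row-surjective i = combine i (zero {1}) , cong proj₁ (remQuot-combine i (zero {1}))

column-surjective : StrictlySurjective _≡_ column
column-surjective j = combine (zero {1}) j , cong proj₂ (remQuot-combine (zero {1}) j)

rows columns : Instance 2 4
rows    = contradictoryPair zero ∘ row
columns = contradictoryPair (suc zero) ∘ column

Indistinguishable : ∀ {n m} → Instance n m → Instance n m → Set
Indistinguishable Φ Ψ = ∀ a → ¬ ¬ (∃[ r ] (Valid Φ a r × Valid Ψ a r))

rows-columns-indistinguishable : Indistinguishable rows columns
rows-columns-indistinguishable a none =
  contradictoryPair-violated zero a λ (i , valid-i) →
  contradictoryPair-violated (suc zero) a λ (j , valid-j) →
  none (violated (combine i j)
       , reindex-violated (contradictoryPair zero) row-surjective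
           -- Here `i` is rewritten as `row (combine i j)`, the form that `reindex-violated`
           -- expects; the column is treated alike.
           (subst (Valid _ a ∘ violated) (sym (cong proj₁ (remQuot-combine i j))) valid-i)
       , reindex-violated (contradictoryPair (suc zero)) column-surjective
           (subst (Valid _ a ∘ violated) (sym (cong proj₂ (remQuot-combine i j))) valid-j))

-- Both runs have the same history, so `A` acts alike in both: it stops with one output, or asks one
-- query whose common answer extends both histories equally. Induction on the two derivations ends
-- the run. The goal is a negation, so the doubly negated common answer may be used.
indistinguishable-output : ∀ {n m} {A : Algorithm n m} {Φ Ψ h} → Indistinguishable Φ Ψ →
  LearnsFrom A Φ h → LearnsFrom A Ψ h → ¬ ¬ (∃[ S ] (IsLiteralSet Φ S × IsLiteralSet Ψ S))
indistinguishable-output ind (stop p S-Φ) (stop q S-Ψ) none with refl ← trans (sym p) q =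
  none (_ , S-Φ , S-Ψ)
indistinguishable-output ind (stop p _) (ask q _) none with () ← trans (sym p) q
indistinguishable-output ind (ask p _) (stop q _) none with () ← trans (sym p) q
indistinguishable-output ind (ask {a} p next-Φ) (ask q next-Ψ) none with refl ← trans (sym p) q =
  ind a λ (r , valid-Φ , valid-Ψ) →
  indistinguishable-output ind (next-Φ r valid-Φ) (next-Ψ r valid-Ψ) none

-- All clauses of `columns` concern the second variable, which becomes visible once `column j` is
-- split.
x₀∉columns : ∀ j → ¬ columns j ≡ pos zero
x₀∉columns j eq with column j
x₀∉columns j () | zero
x₀∉columns j () | suc zero

proposition2 : ¬ (Σ[ A ∈ (∀ n m → Algorithm n m) ]
    (∀ n m (Φ : Instance n m) → Unsatisfiable Φ → Learns (A n m) Φ))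
proposition2 (A , learns) =
  indistinguishable-output rows-columns-indistinguishable
    (learns 2 4 rows (reindex-unsatisfiable (contradictoryPair zero) row-surjective
      (contradictoryPair-unsatisfiable zero)))
    (learns 2 4 columns
      (reindex-unsatisfiable (contradictoryPair (suc zero)) column-surjective
        (contradictoryPair-unsatisfiable (suc zero))))
    λ (S , S-rows , S-columns) →
      -- Clause `zero` of `rows` computes to `pos zero`, so the shared output contains a literal
      -- absent from `columns`.
      let x₀∈S      = Equivalence.from (S-rows (pos zero)) (zero , refl)
          j , Ψj≡x₀ = Equivalence.to (S-columns (pos zero)) x₀∈S
      in x₀∉columns j Ψj≡x₀
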